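{- Let $q$ be a prime power, let $n\geq 2$ and $1\leq s\leq 2n-1$ be integers with $\gcd(s,n)=1$, and let $\alpha,\beta\in\mathbb{F}_{q^{2n}}$ satisfy $\mathrm{N}_{q^{2n}/q^n}(\alpha)\neq \mathrm{N}_{q^{2n}/q^n}(\beta)$. Let $\sigma\colon x\mapsto x^{q^s}$, let $f(x)=\alpha x^{\sigma}+\beta x^{\sigma q^n}=\alpha x^{q^s}+\beta x^{q^{s+n}}$ for $x\in\mathbb{F}_{q^{2n}}$, and let $U_f=\{(x,f(x))\colon x\in\mathbb{F}_{q^{2n}}\}$. Then each point of the $\mathbb{F}_q$-linear set $L_f=L_{U_f}$ of $\mathrm{PG}(1,q^{2n})$ has weight at most two with respect to $L_f$.
   Context: $\mathrm{N}_{q^{2n}/q^n}(x)=x^{q^n+1}$ is the norm from $\mathbb{F}_{q^{2n}}$ to $\mathbb{F}_{q^n}$. The points of $\mathrm{PG}(1,q^{2n})=\mathrm{PG}(\mathbb{F}_{q^{2n}}\times\mathbb{F}_{q^{2n}},\mathbb{F}_{q^{2n}})$ are the 1-dimensional $\mathbb{F}_{q^{2n}}$-subspaces of $\mathbb{F}_{q^{2n}}\times\mathbb{F}_{q^{2n}}$. For an $\mathbb{F}_q$-subspace $U$ of $\mathbb{F}_{q^{2n}}\times\mathbb{F}_{q^{2n}}$, the $\mathbb{F}_q$-linear set defined by $U$ is the point set $L_U=\{\langle \mathbf{u}\rangle_{\mathbb{F}_{q^{2n}}}\colon \mathbf{u}\in U\setminus\{\mathbf{0}\}\}$. The weight of a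 point $P=\langle \mathbf{v}\rangle_{\mathbb{F}_{q^{2n}}}$ with respect to $L_U$ is $\dim_{\mathbb{F}_q}(\langle \mathbf{v}\rangle_{\mathbb{F}_{q^{2n}}}\cap U)$. -}

module Defs where

open import Algebra.Apartness.Bundles using (HeytingCommutativeRing; HeytingField)
open import Algebra.Bundles using (CommutativeRing; Ring)
open import Algebra.Module.Bundles using (LeftModule)
import Algebra.Module.Construct.DirectProduct as DirectProduct
import Algebra.Module.Construct.TensorUnit as TensorUnit
open import Algebra.Morphism.Structures using (module RingMorphisms)
import Algebra.Properties.CommutativeMonoid.Sum as Sum
import Algebra.Properties.Semiring.Exp as Exp
open import Data.Fin.Base using (Fin)
open import Data.Nat.Base as ℕ using (ℕ)
open import Data.Nat.Primality using (Prime)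
open import Data.Product.Base using (∃-syntax; _×_; _,_)
open import Data.Vec.Functional using (Vector)
open import Function.Bundles using (Inverse)
open import Level using (Level; _⊔_)
open import Relation.Binary.Bundles using (Setoid)
open import Relation.Binary.PropositionalEquality.Core using (_≡_)
open import Relation.Binary.PropositionalEquality.Properties using () renaming (setoid to ≡-setoid)
open import Relation.Nullary.Negation using (¬_)
open import Relation.Unary using (Pred; _∈_; _∩_; _≐_)

private
  variable
    a b c c′ ℓ ℓ′ ℓ# ℓ#′ m ℓm p : Level

IsPrimePower : ℕ → Set
IsPrimePower q = ∃[ r ] ∃[ e ] Prime r × 1 ℕ.≤ e × q ≡ r ℕ.^ e

HasCardinality : Setoid a b → ℕ → Set (a ⊔ b)
HasCardinality S N = Inverse S (≡-setoid (Fin N))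

-- For a field with finitely many elements, _≈_ and _#_ are decidable and x # y
-- is equivalent to ¬ (x ≈ y), so a finite Heyting field is a finite field in
-- the usual sense.

module Field (F : HeytingField c ℓ ℓ#) where
  open CommutativeRing (HeytingCommutativeRing.commutativeRing (HeytingField.heytingCommutativeRing F))
    using (ring; semiring; rawRing; setoid) public

module _ {R : Ring c ℓ} (M : LeftModule R m ℓm) where
  open Ring R
  open LeftModule M
  open Sum +ᴹ-commutativeMonoid using (sum)

  linearCombination : ∀ {d} → Vector Carrier d → Vector Carrierᴹ d → Carrierᴹ
  linearCombination r v = sum (λ i → r i *ₗ v i)

  Span : ∀ {d} → Vector Carrierᴹ d → Pred Carrierᴹ (c ⊔ ℓm)
  Span v w = ∃[ r ] w ≈ᴹ linearCombination r v

  LinearlyIndependent : ∀ {d} → Vector Carrierᴹ d → Set (c ⊔ ℓ ⊔ ℓm)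
  LinearlyIndependent v =
    ∀ r → linearCombination r v ≈ᴹ 0ᴹ → ∀ i → r i ≈ 0#

  -- W ≐ Span v also forces W to be a submodule.
  HasDimension : Pred Carrierᴹ p → ℕ → Set (c ⊔ ℓ ⊔ m ⊔ ℓm ⊔ p)
  HasDimension W d =
    ∃[ v ] LinearlyIndependent {d} v × W ≐ Span v

module _ {R : Ring c ℓ} {S : Ring c′ ℓ′} where
  private
    module R = Ring R
    module S = Ring S
  open RingMorphisms R.rawRing S.rawRing using (IsRingHomomorphism)

  restrictScalars : {ι : R.Carrier → S.Carrier} → IsRingHomomorphism ι →
                    LeftModule S m ℓm → LeftModule R m ℓm
  restrictScalars {ι = ι} ι-hom M = record
    { Carrierᴹ = Carrierᴹ
    ; _≈ᴹ_ = _≈ᴹ_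
    ; _+ᴹ_ = _+ᴹ_
    ; _*ₗ_ = λ r v → ι r *ₗ v
    ; 0ᴹ = 0ᴹ
    ; -ᴹ_ = -ᴹ_
    ; isLeftModule = record
      { isLeftSemimodule = record
        { +ᴹ-isCommutativeMonoid = +ᴹ-isCommutativeMonoid
        ; isPreleftSemimodule = record
          { *ₗ-cong = λ r≈s → *ₗ-cong (⟦⟧-cong r≈s)
          ; *ₗ-zeroˡ = λ v → ≈ᴹ-trans (*ₗ-congʳ 0#-homo) (*ₗ-zeroˡ v)
          ; *ₗ-distribʳ = λ v r s →
              ≈ᴹ-trans (*ₗ-congʳ (+-homo r s)) (*ₗ-distribʳ v (ι r) (ι s))
          ; *ₗ-identityˡ = λ v → ≈ᴹ-trans (*ₗ-congʳ 1#-homo) (*ₗ-identityˡ v)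
          ; *ₗ-assoc = λ r s v →
              ≈ᴹ-trans (*ₗ-congʳ (*-homo r s)) (*ₗ-assoc (ι r) (ι s) v)
          ; *ₗ-zeroʳ = λ r → *ₗ-zeroʳ (ι r)
          ; *ₗ-distribˡ = λ r → *ₗ-distribˡ (ι r)
          }
        }
      ; -ᴹ‿cong = -ᴹ‿cong
      ; -ᴹ‿inverse = -ᴹ‿inverse
      }
    }
    where
    open LeftModule M
    open IsRingHomomorphism ι-hom

module Extension
  (K : HeytingField c ℓ ℓ#) (F : HeytingField c′ ℓ′ ℓ#′)
  {ι : HeytingField.Carrier K → HeytingField.Carrier F}
  (ι-hom : RingMorphisms.IsRingHomomorphism (Field.rawRing K) (Field.rawRing F) ι)
  where

  F×F : LeftModule (Field.ring F) c′ ℓ′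
  F×F = DirectProduct.leftModule TensorUnit.leftModule TensorUnit.leftModule

  F×F-over-K : LeftModule (Field.ring K) c′ ℓ′
  F×F-over-K = restrictScalars ι-hom F×F

  open LeftModule F×F

  ⟨_⟩ : Carrierᴹ → Pred Carrierᴹ (c′ ⊔ ℓ′)
  ⟨ v ⟩ w = ∃[ t ] w ≈ᴹ t *ₗ v

  -- A point of PG(1, F) is represented by the set of its vectors.
  LinearSet : Pred Carrierᴹ p → Pred (Pred Carrierᴹ (c′ ⊔ ℓ′)) (c′ ⊔ ℓ′ ⊔ p)
  LinearSet U P = ∃[ u ] u ∈ U × ¬ (u ≈ᴹ 0ᴹ) × P ≐ ⟨ u ⟩

  HasWeight : Pred Carrierᴹ p → Pred Carrierᴹ (c′ ⊔ ℓ′) → ℕ →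
              Set (c ⊔ ℓ ⊔ c′ ⊔ ℓ′ ⊔ p)
  HasWeight U P w = HasDimension F×F-over-K (P ∩ U) w

  Graph : (HeytingField.Carrier F → HeytingField.Carrier F) → Pred Carrierᴹ (c′ ⊔ ℓ′)
  Graph f w = ∃[ x ] w ≈ᴹ (x , f x)

module _ (F : HeytingField c ℓ ℓ#) where
  open HeytingField F
  open Exp (Field.semiring F) using (_^_)

  -- The norm from the field with q²ⁿ elements to its subfield with qⁿ elements.
  norm : (q n : ℕ) → Carrier → Carrier
  norm q n x = x ^ (q ℕ.^ n ℕ.+ 1)

  binomial : (q n s : ℕ) (α β : Carrier) → Carrier → Carrier
  binomial q n s α β x = α * x ^ (q ℕ.^ s) + β * x ^ (q ℕ.^ (s ℕ.+ n))

{-# OPTIONS --safe #-}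

-- Write τ x = x^(qⁿ) and Δ x y = x τ(y) - y τ(x). The vectors of U_f on the
-- point of (x₀ , f x₀) are the (x , f x) with f x = m x, where m = f x₀ / x₀.
-- Applying τ to α σ(x) + β σ(τ x) = m x gives a second linear equation for
-- σ(x) and σ(τ x), whence D σ(Δ x y) = m τ(m) Δ x y for two solutions x and y,
-- with D = N(α) - N(β) ≠ 0. So quotients of values of Δ are fixed by σ, and
-- also by τ since τ(Δ x y) = - Δ x y; as gcd(s , n) = 1, they lie in 𝔽_q. If
-- Δ x y ≠ 0, Cramer's rule (Δ x y) z = (Δ z y) x + (Δ x z) y writes every
-- solution z as an 𝔽_q-combination of x and y. If Δ x₀ z = 0 for every
-- solution z, then z / x₀ is fixed by τ and σ, so z is an 𝔽_q-multiple of x₀.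
module Submission where

open import Defs
open import Algebra.Apartness.Bundles using (HeytingCommutativeRing; HeytingField)
import Algebra.Apartness.Properties.HeytingCommutativeRing as HeytingProperties
open import Algebra.Bundles using (CommutativeMonoid; CommutativeRing; CommutativeSemiring; RawRing)
open import Algebra.Morphism.Structures using (module RingMorphisms)
import Algebra.Properties.CommutativeMonoid.Sum as CommutativeMonoidSum
import Algebra.Properties.CommutativeSemigroup as CommutativeSemigroupProperties
import Algebra.Properties.CommutativeSemiring.Binomial as Binomial
import Algebra.Properties.CommutativeSemiring.Exp as Exp
import Algebra.Properties.Ring as RingProperties
import Algebra.Properties.Semiring.Mult as SemiringMult
import Algebra.Solver.Ring as RingSolver
open import Algebra.Solver.Ring.AlmostCommutativeRing
  using (fromCommutativeRing; _-Raw-AlmostCommutative⟶_)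
open import Data.Fin.Base using (Fin; zero; suc; punchIn; toℕ; fromℕ; inject₁)
open import Data.Fin.Properties as Fin
  using (any?; punchInᵢ≢i; suc-injective; toℕ<n; toℕ-fromℕ; toℕ-inject₁)
open import Data.Maybe.Base using (Maybe; just; nothing)
open import Data.Nat.Base as ℕ using (ℕ; zero; suc; _!; _∸_; NonZero)
open import Data.Nat.Combinatorics using (_C_; nCn≡1; nCk≡n!/k![n-k]!; k![n∸k]!∣n!)
open import Data.Nat.Divisibility using (_∣_; divides; ∣⇒≤; m∣m*n)
open import Data.Nat.DivMod using (m/n*n≡m)
open import Data.Nat.GCD using (gcd; gcd-GCD; GCD; module Bézout)
open import Data.Nat.Primality using (Prime; euclidsLemma; prime⇒nonTrivial; prime⇒nonZero)
import Data.Nat.Properties as ℕ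
open import Data.Product.Base using (_×_; _,_; ∃-syntax; proj₁; proj₂)
open import Data.Sum.Base using (inj₁; inj₂)
open import Data.Vec.Base using (Vec; []; _∷_; replicate)
open import Data.Vec.Functional as Vector using (Vector)
open import Function.Bundles using (Inverse)
import Function.Construct.Composition as Composition
import Function.Construct.Symmetry as Symmetry
open import Level using (Level)
open import Relation.Binary.Bundles using (Setoid)
open import Relation.Binary.PropositionalEquality as ≡ using (_≡_; _≢_)
open import Relation.Nullary using (¬_; Dec; yes; no; contradiction)
open import Relation.Nullary.Decidable using (_×-dec_; ¬?; decidable-stable; map′)
open import Relation.Unary using (Decidable; Pred; _∈_; _∩_; _⊆_)

private
  variable
    a b c c′ ℓ ℓ′ ℓ# ℓ#′ : Level

-- Polynomial identities in commutative rings

-- The coefficient (m , n) stands for the integer m - n: the ring solver only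
-- cancels terms if equality of its coefficients is decidable.
module IntegerCoefficients (R : CommutativeRing c ℓ) where
  open CommutativeRing R
  open RingProperties ring
  open SemiringMult semiring using (×-homo-+; ×1-homo-*; ×-congˡ) renaming (_×_ to _×′_)
  open CommutativeSemigroupProperties +-commutativeSemigroup using (interchange)
  open import Relation.Binary.Reasoning.Setoid setoid

  private
    differences : RawRing _ _
    differences = record
      { Carrier = ℕ × ℕ
      ; _≈_ = _≡_
      ; _+_ = λ (m , n) (m′ , n′) → m ℕ.+ m′ , n ℕ.+ n′
      ; _*_ = λ (m , n) (m′ , n′) → m ℕ.* m′ ℕ.+ n ℕ.* n′ , m ℕ.* n′ ℕ.+ n ℕ.* m′
      ; -_ = λ (m , n) → n , m
      ; 0# = 0 , 0
      ; 1# = 1 , 0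
      }

    ⟦_⟧ : ℕ × ℕ → Carrier
    ⟦ m , n ⟧ = m ×′ 1# - n ×′ 1#

    +-rearrange : ∀ x y z w → (x + z) - (y + w) ≈ (x - y) + (z - w)
    +-rearrange x y z w = begin
      (x + z) - (y + w)      ≈⟨ +-congˡ (-‿+-comm y w) ⟨
      (x + z) + (- y - w)    ≈⟨ interchange x z (- y) (- w) ⟩
      (x - y) + (z - w)      ∎

    *-rearrange : ∀ x y z w → (x * z + y * w) - (x * w + y * z) ≈ (x - y) * (z - w)
    *-rearrange x y z w = begin
      (x * z + y * w) - (x * w + y * z)    ≈⟨ +-rearrange _ _ _ _ ⟩
      (x * z - x * w) + (y * w - y * z)    ≈⟨ +-cong (x[y-z]≈xy-xz x z w) (x[y-z]≈xy-xz y w z) ⟨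
      x * (z - w) + y * (w - z)            ≈⟨ +-congˡ (*-congˡ (⁻¹-anti-homo-// z w)) ⟨
      x * (z - w) + y * - (z - w)          ≈⟨ +-congˡ (-‿distribʳ-* y (z - w)) ⟨
      x * (z - w) - y * (z - w)            ≈⟨ [y-z]x≈yx-zx (z - w) x y ⟨
      (x - y) * (z - w)                    ∎

    morphism : differences -Raw-AlmostCommutative⟶ fromCommutativeRing R
    morphism = record
      { ⟦_⟧ = ⟦_⟧
      ; +-homo = λ (m , n) (m′ , n′) → trans
          (+-cong (×-homo-+ 1# m m′) (-‿cong (×-homo-+ 1# n n′)))
          (+-rearrange _ _ _ _)
      ; *-homo = λ (m , n) (m′ , n′) → trans
          (+-cong
            (trans (×-homo-+ 1# (m ℕ.* m′) (n ℕ.* n′)) (+-cong (×1-homo-* m m′) (×1-homo-* n n′)))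
            (-‿cong
              (trans (×-homo-+ 1# (m ℕ.* n′) (n ℕ.* m′)) (+-cong (×1-homo-* m n′) (×1-homo-* n m′)))))
          (*-rearrange _ _ _ _)
      ; -‿homo = λ (m , n) → sym (⁻¹-anti-homo-// (m ×′ 1#) (n ×′ 1#))
      ; 0-homo = -‿inverseʳ 0#
      ; 1-homo = trans (+-congˡ -0#≈0#) (trans (+-identityʳ _) (+-identityʳ 1#))
      }

    -- The hypothesis says that m - n and m′ - n′ are the same integer.
    ⟦⟧-cong : ∀ m n m′ n′ → m ℕ.+ n′ ≡ m′ ℕ.+ n → ⟦ m , n ⟧ ≈ ⟦ m′ , n′ ⟧
    ⟦⟧-cong m n m′ n′ eq = x∙y⁻¹≈ε⇒x≈y _ _ (begin
      (x - y) - (z - w)  ≈⟨ +-congˡ (⁻¹-anti-homo-// z w) ⟩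
      (x - y) + (w - z)  ≈⟨ +-rearrange x y w z ⟨
      (x + w) - (y + z)  ≈⟨ +-cong (×-homo-+ 1# m n′) (-‿cong (trans (×-homo-+ 1# m′ n) (+-comm z y))) ⟨
      (m ℕ.+ n′) ×′ 1# - (m′ ℕ.+ n) ×′ 1#  ≈⟨ +-congʳ (×-congˡ eq) ⟩
      (m′ ℕ.+ n) ×′ 1# - (m′ ℕ.+ n) ×′ 1#  ≈⟨ -‿inverseʳ _ ⟩
      0#  ∎)
      where
      x = m ×′ 1#
      y = n ×′ 1#
      z = m′ ×′ 1#
      w = n′ ×′ 1#

    _coeff≟_ : ∀ i j → Maybe (⟦ i ⟧ ≈ ⟦ j ⟧)
    (m , n) coeff≟ (m′ , n′) with m ℕ.+ n′ ℕ.≟ m′ ℕ.+ n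
    ... | yes eq = just (⟦⟧-cong m n m′ n′ eq)
    ... | no  _  = nothing

  open RingSolver differences (fromCommutativeRing R) morphism _coeff≟_ public

module _ (R : CommutativeRing c ℓ) where
  open CommutativeRing R
  open IntegerCoefficients R

  -- This is det (B A) = det B det A for B = (α , β ; γ , δ) and the matrix A with columns (x , y)
  -- and (z , w).
  determinant-multiplicative : ∀ α β γ δ x y z w →
    (α * x + β * y) * (γ * z + δ * w) - (α * z + β * w) * (γ * x + δ * y) ≈
    (δ * α - γ * β) * (x * w - z * y)
  determinant-multiplicative = solve 8 (λ α β γ δ x y z w →
    ((α :* x :+ β :* y) :* (γ :* z :+ δ :* w) :- (α :* z :+ β :* w) :* (γ :* x :+ δ :* y)) :=
    ((δ :* α :- γ :* β) :* (x :* w :- z :* y))) refl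

  -- Expansion along the first row of the vanishing 3 by 3 determinant whose first two rows are both
  -- (x , y , z) and whose third row is (x′ , y′ , z′).
  cramer : ∀ x y z x′ y′ z′ →
    z * (x * y′ - y * x′) ≈ (z * y′ - y * z′) * x + (x * z′ - z * x′) * y
  cramer = solve 6 (λ x y z x′ y′ z′ →
    z :* (x :* y′ :- y :* x′) := (z :* y′ :- y :* z′) :* x :+ (x :* z′ :- z :* x′) :* y) refl

-- Finite sums in commutative monoids

module _ (M : CommutativeMonoid c ℓ) where
  open CommutativeMonoid M
  open CommutativeMonoidSum M

  sum-single : ∀ {n} (t : Vector Carrier n) i → (∀ j → i ≢ j → t j ≈ ε) → sum t ≈ t i
  sum-single {suc n} t i zeros = trans (sum-remove {i = i} t) (trans
    (∙-congˡ (trans (sum-cong-≋ (λ j → zeros (punchIn i j) (λ i≡ → punchInᵢ≢i i j (≡.sym i≡))))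
                    (sum-replicate-zero n)))
    (identityʳ _))

  -- Conjugating `h` by the enumeration `card` gives a permutation of `Fin N`, under which a finite
  -- sum is invariant.
  sum-reindex : (S : Setoid a b) {N : ℕ} (card : HasCardinality S N) (h : Inverse S S)
    (g : Setoid.Carrier S → Carrier) → (∀ {x y} → Setoid._≈_ S x y → g x ≈ g y) →
    let open Inverse card in
    sum (λ i → g (from i)) ≈ sum (λ i → g (Inverse.to h (from i)))
  sum-reindex S {N} card h g g-cong = trans
    (sum-permute (λ i → g (from i)) π)
    (sum-cong-≋ {N} (λ i → g-cong (strictlyInverseʳ (Inverse.to h (from i)))))
    where
    open Inverse card
    π = Composition.inverse (Composition.inverse (Symmetry.inverse card) h) card

-- Arithmetic of a finite field with N elements

module FiniteField (F : HeytingField c ℓ ℓ#) {N : ℕ} (card : HasCardinality (Field.setoid F) N) where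
  open HeytingField F using (heytingCommutativeRing; #⇒invertible; tight)
  open HeytingCommutativeRing heytingCommutativeRing using (commutativeRing) public
  open CommutativeRing commutativeRing hiding (zero) public
  open HeytingProperties heytingCommutativeRing using (1#0; x-0≈x)
  open RingProperties ring
  open Exp commutativeSemiring
  open SemiringMult semiring using () renaming (_×_ to _×′_)
  open Inverse card using (to; from; to-cong; strictlyInverseʳ)
  open import Relation.Binary.Reasoning.Setoid setoid

  infix 4 _≟_
  _≟_ : ∀ x y → Dec (x ≈ y)
  x ≟ y = map′
    (λ eq → trans (sym (strictlyInverseʳ x)) (trans (reflexive (≡.cong from eq)) (strictlyInverseʳ y)))
    to-cong
    (to x Fin.≟ to y)

  -- Exhaustive search along the enumeration; it supplies inverses here and decides the final case
  -- distinction on weights.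
  ∃? : ∀ {p} {P : Pred Carrier p} → (∀ {x y} → x ≈ y → P x → P y) → Decidable P → Dec (∃[ x ] P x)
  ∃? resp P? = map′
    (λ (i , Pi) → from i , Pi)
    (λ (x , Px) → to x , resp (sym (strictlyInverseʳ x)) Px)
    (any? (λ i → P? (from i)))

  1≉0 : ¬ 1# ≈ 0#
  1≉0 1≈0 = proj₂ (tight 1# 0#) 1≈0 1#0

  -- Tightness only gives ¬ ¬ x # 0#; the search for an inverse makes this constructive.
  inverse : ∀ {x} → ¬ x ≈ 0# → ∃[ y ] x * y ≈ 1#
  inverse {x} x≉0 = decidable-stable
    (∃? (λ y≈z xy≈1 → trans (*-congˡ (sym y≈z)) xy≈1) (λ y → x * y ≟ 1#))
    (λ ¬inv → x≉0 (proj₁ (tight x 0#) (λ x#0 →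
      let (y , _ , xy≈1) = #⇒invertible x#0
      in ¬inv (y , trans (*-congʳ (sym (x-0≈x x))) xy≈1))))

  *-cancelˡ : ∀ {x y z} → ¬ x ≈ 0# → x * y ≈ x * z → y ≈ z
  *-cancelˡ {x} {y} {z} x≉0 xy≈xz = begin
    y              ≈⟨ x⁻¹[xw]≈w y ⟨
    x⁻¹ * (x * y)  ≈⟨ *-congˡ xy≈xz ⟩
    x⁻¹ * (x * z)  ≈⟨ x⁻¹[xw]≈w z ⟩
    z              ∎
    where
    x⁻¹ = proj₁ (inverse x≉0)
    x⁻¹[xw]≈w : ∀ w → x⁻¹ * (x * w) ≈ w
    x⁻¹[xw]≈w w = trans (sym (*-assoc x⁻¹ x w))
      (trans (*-congʳ (trans (*-comm x⁻¹ x) (proj₂ (inverse x≉0)))) (*-identityˡ w))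

  *-cancelʳ : ∀ {x y z} → ¬ x ≈ 0# → y * x ≈ z * x → y ≈ z
  *-cancelʳ {x} {y} {z} x≉0 yx≈zx =
    *-cancelˡ x≉0 (trans (*-comm x y) (trans yx≈zx (*-comm z x)))

  xy≈0⇒y≈0 : ∀ {x y} → ¬ x ≈ 0# → x * y ≈ 0# → y ≈ 0#
  xy≈0⇒y≈0 {x} x≉0 xy≈0 = *-cancelˡ x≉0 (trans xy≈0 (sym (zeroʳ x)))

  *-nonzero : ∀ {x y} → ¬ x ≈ 0# → ¬ y ≈ 0# → ¬ x * y ≈ 0#
  *-nonzero x≉0 y≉0 xy≈0 = y≉0 (xy≈0⇒y≈0 x≉0 xy≈0)

  xᵏ≈0⇒x≈0 : ∀ x k → x ^ k ≈ 0# → x ≈ 0#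
  xᵏ≈0⇒x≈0 x zero    1≈0  = contradiction 1≈0 1≉0
  xᵏ≈0⇒x≈0 x (suc k) x*xᵏ≈0 with x ≟ 0#
  ... | yes x≈0 = x≈0
  ... | no  x≉0 = xᵏ≈0⇒x≈0 x k (xy≈0⇒y≈0 x≉0 x*xᵏ≈0)

  divide : ∀ {x} → ¬ x ≈ 0# → ∀ y → ∃[ z ] y ≈ z * x
  divide {x} x≉0 y = let (x⁻¹ , xx⁻¹≈1) = inverse x≉0 in
    y * x⁻¹ , sym (trans (*-assoc y x⁻¹ x)
      (trans (*-congˡ (trans (*-comm x⁻¹ x) xx⁻¹≈1)) (*-identityʳ y)))

  -- Translation by x permutes the field, so the sum of all elements does not change when x is added
  -- to each of its N terms.
  N×x≈0 : ∀ x → N ×′ x ≈ 0#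
  N×x≈0 x = sym (+-cancelˡ (sum from) 0# (N ×′ x) (begin
    sum from + 0#                     ≈⟨ +-identityʳ _ ⟩
    sum from                          ≈⟨ sum-reindex +-commutativeMonoid setoid card translation (λ y → y) (λ eq → eq) ⟩
    sum (λ i → from i + x)            ≈⟨ ∑-distrib-+ from (λ _ → x) ⟩
    sum from + sum {N} (λ _ → x)      ≈⟨ +-congˡ (sum-replicate N) ⟩
    sum from + N ×′ x                 ∎))
    where
    open CommutativeMonoidSum +-commutativeMonoid
    y+w+z≈y : ∀ y {w z} → w + z ≈ 0# → y + w + z ≈ y
    y+w+z≈y y w+z≈0 = trans (+-assoc y _ _) (trans (+-congˡ w+z≈0) (+-identityʳ y))
    translation : Inverse setoid setoid
    translation = record
      { to = _+ x
      ; from = _- x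
      ; to-cong = +-congʳ
      ; from-cong = +-congʳ
      ; inverse = (λ {y} z≈y-x → trans (+-congʳ z≈y-x) (y+w+z≈y y (-‿inverseˡ x)))
                , (λ {y} z≈y+x → trans (+-congʳ z≈y+x) (y+w+z≈y y (-‿inverseʳ x)))
      }

  -- The product of the nonzero elements is invariant under multiplication by
  -- x; u replaces the factor 0# by 1#, and δ accounts for this factor.
  x^N≈x : ∀ x → x ^ N ≈ x
  x^N≈x x with x ≟ 0#
  ... | yes x≈0 = begin
    x ^ N        ≈⟨ ^-congˡ N x≈0 ⟩
    0# ^ N       ≈⟨ 0^ (to 0#) ⟩
    0#           ≈⟨ x≈0 ⟨
    x            ∎
    where
    -- An element of `Fin k` guarantees k > 0; for k = 0 the power would be `1#`.
    0^ : ∀ {k} → Fin k → 0# ^ k ≈ 0#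
    0^ {suc k} _ = zeroˡ (0# ^ k)
  ... | no x≉0 = *-cancelʳ ∏u≉0 (begin
    x ^ N * ∏ u∘from                        ≈⟨ *-congʳ (∏-replicate N) ⟨
    ∏ {N} (λ _ → x) * ∏ u∘from              ≈⟨ ∏-distrib-* (λ _ → x) u∘from ⟨
    ∏ (λ i → x * u (from i))                ≈⟨ ∏-cong {N} (λ i → x*u (from i)) ⟩
    ∏ (λ i → δ (from i) * u (x * from i))   ≈⟨ ∏-distrib-* (λ i → δ (from i)) (λ i → u (x * from i)) ⟩
    ∏ (λ i → δ (from i)) * ∏ (λ i → u (x * from i))
      ≈⟨ *-cong ∏δ≈x (sym (sum-reindex *-commutativeMonoid setoid card scaling u u-cong)) ⟩
    x * ∏ u∘from                            ∎)
    where
    open CommutativeMonoidSum *-commutativeMonoid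
      renaming (sum to ∏; sum-replicate to ∏-replicate; ∑-distrib-+ to ∏-distrib-*; sum-cong-≋ to ∏-cong)
    u δ : Carrier → Carrier
    u y with y ≟ 0#
    ... | yes _ = 1#
    ... | no  _ = y
    δ y with y ≟ 0#
    ... | yes _ = x
    ... | no  _ = 1#
    u∘from : Fin N → Carrier
    u∘from i = u (from i)
    u-zero : ∀ {y} → y ≈ 0# → u y ≈ 1#
    u-zero {y} y≈0 with y ≟ 0#
    ... | yes _   = refl
    ... | no  y≉0 = contradiction y≈0 y≉0
    u-nonzero : ∀ {y} → ¬ y ≈ 0# → u y ≈ y
    u-nonzero {y} y≉0 with y ≟ 0#
    ... | yes y≈0 = contradiction y≈0 y≉0
    ... | no  _   = refl
    u-cong : ∀ {y z} → y ≈ z → u y ≈ u z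
    u-cong {y} {z} y≈z with z ≟ 0#
    ... | yes z≈0 = u-zero (trans y≈z z≈0)
    ... | no  z≉0 = trans (u-nonzero (λ y≈0 → z≉0 (trans (sym y≈z) y≈0))) y≈z
    x*u : ∀ y → x * u y ≈ δ y * u (x * y)
    x*u y with y ≟ 0#
    ... | yes y≈0 = *-congˡ (sym (u-zero (trans (*-congˡ y≈0) (zeroʳ x))))
    ... | no  y≉0 = sym (trans (*-identityˡ _) (u-nonzero (*-nonzero x≉0 y≉0)))
    δ-zero : ∀ {y} → y ≈ 0# → δ y ≈ x
    δ-zero {y} y≈0 with y ≟ 0#
    ... | yes _   = refl
    ... | no  y≉0 = contradiction y≈0 y≉0
    δ-nonzero : ∀ {y} → ¬ y ≈ 0# → δ y ≈ 1#
    δ-nonzero {y} y≉0 with y ≟ 0#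
    ... | yes y≈0 = contradiction y≈0 y≉0
    ... | no  _   = refl
    ∏δ≈x : ∏ (λ i → δ (from i)) ≈ x
    ∏δ≈x = trans
      (sum-single *-commutativeMonoid (λ i → δ (from i)) (to 0#)
        (λ j to0≢j → δ-nonzero (λ fromj≈0 →
          to0≢j (≡.trans (to-cong (sym fromj≈0)) (Inverse.strictlyInverseˡ card j)))))
      (δ-zero (strictlyInverseʳ 0#))
    ∏-nonzero : ∀ {k} (t : Fin k → Carrier) → (∀ i → ¬ t i ≈ 0#) → ¬ ∏ t ≈ 0#
    ∏-nonzero {zero}  t t≉0 = 1≉0
    ∏-nonzero {suc k} t t≉0 = *-nonzero (t≉0 zero) (∏-nonzero (λ i → t (suc i)) (λ i → t≉0 (suc i)))
    u≉0 : ∀ y → ¬ u y ≈ 0#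
    u≉0 y with y ≟ 0#
    ... | yes _   = 1≉0
    ... | no  y≉0 = y≉0
    ∏u≉0 : ¬ ∏ u∘from ≈ 0#
    ∏u≉0 = ∏-nonzero u∘from (λ i → u≉0 (from i))
    x⁻¹ = proj₁ (inverse x≉0)
    x⁻¹x≈1 = trans (*-comm x⁻¹ x) (proj₂ (inverse x≉0))
    scaling : Inverse setoid setoid
    scaling = record
      { to = x *_
      ; from = x⁻¹ *_
      ; to-cong = *-congˡ
      ; from-cong = *-congˡ
      ; inverse =
          (λ {y} z≈x⁻¹y → trans (*-congˡ z≈x⁻¹y)
            (trans (sym (*-assoc x x⁻¹ y)) (trans (*-congʳ (proj₂ (inverse x≉0))) (*-identityˡ y))))
        , (λ {y} z≈xy → trans (*-congˡ z≈xy)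
            (trans (sym (*-assoc x⁻¹ x y)) (trans (*-congʳ x⁻¹x≈1) (*-identityˡ y))))
      }

-- Binomial coefficients modulo a prime

-- By Euclid's lemma p would divide one of the factors 1 , ... , k, all of which are smaller than p.
prime∤! : ∀ {p} → Prime p → ∀ k → k ℕ.< p → ¬ p ∣ k !
prime∤! p-prime zero k<p p∣1 = ℕ.<⇒≱ (ℕ.nonTrivial⇒n>1 _ {{prime⇒nonTrivial p-prime}}) (∣⇒≤ p∣1)
prime∤! p-prime (suc k) 1+k<p p∣[1+k]! with euclidsLemma (suc k) (k !) p-prime p∣[1+k]!
... | inj₁ p∣1+k = ℕ.<⇒≱ 1+k<p (∣⇒≤ p∣1+k)
... | inj₂ p∣k!  = prime∤! p-prime k (ℕ.<-trans (ℕ.n<1+n k) 1+k<p) p∣k!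

-- The prime p divides p ! = (p C k) · k ! · (p - k) !, but neither k ! nor (p - k) !, since k and p
-- - k are both below p.
prime∣C : ∀ {p} → Prime p → ∀ k → 0 ℕ.< k → k ℕ.< p → p ∣ p C k
prime∣C {p@(suc p-1)} p-prime k 0<k k<p
  with euclidsLemma (p C k) (k ! ℕ.* (p ∸ k) !) p-prime (≡.subst (p ∣_) (≡.sym C*k![p-k]!≡p!) (m∣m*n (p-1 !)))
  where
  instance
    k![p-k]!≢0 : NonZero (k ! ℕ.* (p ∸ k) !)
    k![p-k]!≢0 = k ℕ.!* (p ∸ k) !≢0
  C*k![p-k]!≡p! : (p C k) ℕ.* (k ! ℕ.* (p ∸ k) !) ≡ p !
  C*k![p-k]!≡p! = ≡.trans
    (≡.cong (ℕ._* (k ! ℕ.* (p ∸ k) !)) (nCk≡n!/k![n-k]! (ℕ.<⇒≤ k<p)))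
    (m/n*n≡m (k![n∸k]!∣n! (ℕ.<⇒≤ k<p)))
... | inj₁ p∣C = p∣C
... | inj₂ p∣k![p-k]! with euclidsLemma (k !) ((p ∸ k) !) p-prime p∣k![p-k]!
...   | inj₁ p∣k!     = contradiction p∣k! (prime∤! p-prime k k<p)
...   | inj₂ p∣[p-k]! = contradiction p∣[p-k]!
  (prime∤! p-prime (p ∸ k) (ℕ.∸-monoʳ-< 0<k (ℕ.<⇒≤ k<p)))

-- Additivity and fixed elements of power maps

module _ (R : CommutativeSemiring c ℓ) where
  open CommutativeSemiring R hiding (zero)
  open Exp R
  open SemiringMult semiring using (×-assocˡ; ×-congʳ; ×-homo-1; ×-assoc-*) renaming (_×_ to _×′_)
  open CommutativeMonoidSum +-commutativeMonoid using (sum; sum-cong-≋; sum-init-last; sum-replicate-zero)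
  open import Relation.Binary.Reasoning.Setoid setoid

  k×x≈0 : ∀ k → k ×′ 1# ≈ 0# → ∀ x → k ×′ x ≈ 0#
  k×x≈0 k k×1≈0 x = begin
    k ×′ x          ≈⟨ ×-congʳ k (*-identityˡ x) ⟨
    k ×′ (1# * x)   ≈⟨ ×-assoc-* k 1# x ⟨
    k ×′ 1# * x     ≈⟨ *-congʳ k×1≈0 ⟩
    0# * x          ≈⟨ zeroˡ x ⟩
    0#              ∎

  -- In the binomial expansion the inner coefficients are divisible by p, so only the first and the
  -- last term survive.
  freshman's-dream : ∀ {p} → Prime p → p ×′ 1# ≈ 0# → ∀ x y → (x + y) ^ p ≈ x ^ p + y ^ p
  freshman's-dream {p@(suc p-1)} p-prime p×1≈0 x y = begin
    (x + y) ^ p                              ≈⟨ Binomial.theorem R p x y ⟩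
    first + sum rest                         ≈⟨ +-congˡ (sum-init-last rest) ⟩
    first + (sum (λ i → rest (inject₁ i)) + rest (fromℕ p-1))
      ≈⟨ +-cong first≈ (+-cong (trans (sum-cong-≋ middle≈) (sum-replicate-zero p-1)) last≈) ⟩
    y ^ p + (0# + x ^ p)                     ≈⟨ +-congˡ (+-identityˡ _) ⟩
    y ^ p + x ^ p                            ≈⟨ +-comm _ _ ⟩
    x ^ p + y ^ p                            ∎
    where
    monomial : ℕ → Carrier
    monomial k = x ^ k * y ^ (p ∸ k)
    first = (p C 0) ×′ monomial 0
    rest : Fin p → Carrier
    rest i = (p C suc (toℕ i)) ×′ monomial (suc (toℕ i))
    first≈ : first ≈ y ^ p
    first≈ = trans (×-homo-1 _) (*-identityˡ _)
    middle≈ : ∀ i → rest (inject₁ i) ≈ 0#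
    middle≈ i with p C suc (toℕ (inject₁ i))
      | prime∣C p-prime (suc (toℕ (inject₁ i))) ℕ.z<s
          (ℕ.s<s (≡.subst (ℕ._< p-1) (≡.sym (toℕ-inject₁ i)) (toℕ<n i)))
    ... | _ | divides k ≡.refl = begin
      (k ℕ.* p) ×′ z    ≈⟨ ×-assocˡ z k p ⟨
      k ×′ (p ×′ z)     ≈⟨ ×-congʳ k (k×x≈0 p p×1≈0 z) ⟩
      k ×′ 0#           ≈⟨ ×-congʳ k (zeroˡ 0#) ⟨
      k ×′ (0# * 0#)    ≈⟨ ×-assoc-* k 0# 0# ⟨
      k ×′ 0# * 0#      ≈⟨ zeroʳ _ ⟩
      0#                ∎
      where z = monomial (suc (toℕ (inject₁ i)))
    last≈ : rest (fromℕ p-1) ≈ x ^ p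
    last≈ rewrite toℕ-fromℕ p-1 | nCn≡1 p | ℕ.n∸n≡0 p = trans (×-homo-1 _) (*-identityʳ _)

  Additive : ℕ → Set _
  Additive k = ∀ x y → (x + y) ^ k ≈ x ^ k + y ^ k

  additive-^ : ∀ {k} → Additive k → ∀ e → Additive (k ℕ.^ e)
  additive-^ {k} k-additive zero    x y =
    trans (*-identityʳ _) (sym (+-cong (*-identityʳ x) (*-identityʳ y)))
  additive-^ {k} k-additive (suc e) x y = begin
    (x + y) ^ (k ℕ.* k ℕ.^ e)                  ≈⟨ ^-assocʳ (x + y) k (k ℕ.^ e) ⟨
    ((x + y) ^ k) ^ (k ℕ.^ e)                  ≈⟨ ^-congˡ (k ℕ.^ e) (k-additive x y) ⟩
    (x ^ k + y ^ k) ^ (k ℕ.^ e)                ≈⟨ additive-^ k-additive e (x ^ k) (y ^ k) ⟩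
    (x ^ k) ^ (k ℕ.^ e) + (y ^ k) ^ (k ℕ.^ e)  ≈⟨ +-cong (^-assocʳ x k (k ℕ.^ e)) (^-assocʳ y k (k ℕ.^ e)) ⟩
    x ^ (k ℕ.* k ℕ.^ e) + y ^ (k ℕ.* k ℕ.^ e)  ∎

  Fixed : ℕ → Carrier → Set _
  Fixed k x = x ^ k ≈ x

  -- Raising to the power q^(m k) is the m-fold iterate of raising to the power q^k.
  fixed-^ : ∀ q {x} → ∀ k → Fixed (q ℕ.^ k) x → ∀ m → Fixed (q ℕ.^ (m ℕ.* k)) x
  fixed-^ q {x} k fixed zero    = *-identityʳ x
  fixed-^ q {x} k fixed (suc m) = begin
    x ^ (q ℕ.^ (k ℕ.+ m ℕ.* k))             ≡⟨ ≡.cong (x ^_) (ℕ.^-distribˡ-+-* q k (m ℕ.* k)) ⟩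
    x ^ (q ℕ.^ k ℕ.* q ℕ.^ (m ℕ.* k))       ≈⟨ ^-assocʳ x (q ℕ.^ k) (q ℕ.^ (m ℕ.* k)) ⟨
    (x ^ (q ℕ.^ k)) ^ (q ℕ.^ (m ℕ.* k))     ≈⟨ ^-congˡ (q ℕ.^ (m ℕ.* k)) fixed ⟩
    x ^ (q ℕ.^ (m ℕ.* k))                   ≈⟨ fixed-^ q k fixed m ⟩
    x                                       ∎

  -- Replacing x by x^(q^a) in x^q gives x^(q^(1+a)), which is x again.
  fixed-suc : ∀ q {x a b} → 1 ℕ.+ a ≡ b → Fixed (q ℕ.^ a) x → Fixed (q ℕ.^ b) x → Fixed q x
  fixed-suc q {x} {a} ≡.refl a-fixed 1+a-fixed = begin
    x ^ q                    ≈⟨ ^-congˡ q a-fixed ⟨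
    (x ^ (q ℕ.^ a)) ^ q      ≈⟨ ^-assocʳ x (q ℕ.^ a) q ⟩
    x ^ (q ℕ.^ a ℕ.* q)      ≡⟨ ≡.cong (x ^_) (ℕ.*-comm (q ℕ.^ a) q) ⟩
    x ^ (q ℕ.* q ℕ.^ a)      ≈⟨ 1+a-fixed ⟩
    x                        ∎

  -- Bézout's identity, stated in natural numbers, yields a multiple of s and a multiple of n that
  -- differ by one; x is fixed by both of the corresponding powers.
  fixed-coprime : ∀ q {x} s n → gcd s n ≡ 1 →
                  Fixed (q ℕ.^ s) x → Fixed (q ℕ.^ n) x → Fixed q x
  fixed-coprime q {x} s n gcd≡1 s-fixed n-fixed
    with Bézout.identity (≡.subst (GCD s n) gcd≡1 (gcd-GCD s n))
  ... | Bézout.+- u v 1+vn≡us =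
    fixed-suc q 1+vn≡us (fixed-^ q n n-fixed v) (fixed-^ q s s-fixed u)
  ... | Bézout.-+ u v 1+us≡vn =
    fixed-suc q 1+us≡vn (fixed-^ q s s-fixed u) (fixed-^ q n n-fixed v)

module _ (R : CommutativeRing c ℓ) where
  open CommutativeRing R hiding (zero)
  open Exp commutativeSemiring
  open RingProperties ring
  open RingMorphisms rawRing rawRing using (IsRingHomomorphism)

  additive⇒homomorphism : ∀ k → Additive commutativeSemiring k → IsRingHomomorphism (_^ k)
  additive⇒homomorphism k additive = record
    { isSemiringHomomorphism = record
      { isNearSemiringHomomorphism = record
        { +-isMonoidHomomorphism = record
          { isMagmaHomomorphism = record
            { isRelHomomorphism = record { cong = ^-congˡ k }
            ; homo = additive
            }
          ; ε-homo = 0^k≈0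
          }
        ; *-homo = λ x y → ^-distrib-* x y k
        }
      ; 1#-homo = 1^ k
      }
    ; -‿homo = λ x → +-inverseˡ-unique _ _
        (trans (sym (additive (- x) x)) (trans (^-congˡ k (-‿inverseˡ x)) 0^k≈0))
    }
    where
    -- Additivity gives 0^k + 0^k = 0^k, which covers k = 0 as well.
    0^k≈0 : 0# ^ k ≈ 0#
    0^k≈0 = x+x≈x⇒x≈0 _ (trans (sym (additive 0# 0#)) (^-congˡ k (+-identityʳ 0#)))
    1^ : ∀ j → 1# ^ j ≈ 1#
    1^ zero    = refl
    1^ (suc j) = trans (*-identityˡ _) (1^ j)

-- Roots of monic polynomials

-- The vector of coefficients a₀ , … , a_{d-1} stands for the monic polynomial
-- a₀ + a₁ x + … + a_{d-1} x^{d-1} + x^d.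
module MonicPolynomial (R : CommutativeRing c ℓ) where
  open CommutativeRing R hiding (zero)
  open Exp commutativeSemiring
  open IntegerCoefficients R

  eval : ∀ {d} → Vec Carrier d → Carrier → Carrier
  eval []       x = 1#
  eval (a ∷ as) x = a + x * eval as x

  eval-congʳ : ∀ {d} (as : Vec Carrier d) {x y} → x ≈ y → eval as x ≈ eval as y
  eval-congʳ []       x≈y = refl
  eval-congʳ (a ∷ as) x≈y = +-congˡ (*-cong x≈y (eval-congʳ as x≈y))

  eval-replicate-0 : ∀ d x → eval (replicate d 0#) x ≈ x ^ d
  eval-replicate-0 zero    x = refl
  eval-replicate-0 (suc d) x = trans (+-identityˡ _) (*-congˡ (eval-replicate-0 d x))

  -- Horner's scheme for division by x - r: the coefficients of the quotient are the values at r of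
  -- the successive tails, and its leading coefficient 1 stays implicit.
  quotient : ∀ {d} → Vec Carrier (suc d) → Carrier → Vec Carrier d
  quotient (a ∷ [])         r = []
  quotient (a ∷ as@(_ ∷ _)) r = eval as r ∷ quotient as r

  eval-quotient : ∀ {d} (as : Vec Carrier (suc d)) r x →
                  eval as x ≈ eval as r + (x - r) * eval (quotient as r) x
  eval-quotient (a ∷ []) r x =
    solve 4 (λ a r x e → a :+ x :* e := a :+ r :* e :+ (x :- r) :* e) refl a r x 1#
  eval-quotient (a ∷ as@(_ ∷ _)) r x = trans
    (+-congˡ (*-congˡ (eval-quotient as r x)))
    (solve 5 (λ a r x e e′ →
      a :+ x :* (e :+ (x :- r) :* e′) := a :+ r :* e :+ (x :- r) :* (e :+ x :* e′))
      refl a r x (eval as r) (eval (quotient as r) x))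

module _ (F : HeytingField c ℓ ℓ#) {N : ℕ} (card : HasCardinality (Field.setoid F) N) where
  open FiniteField F card
  open MonicPolynomial commutativeRing
  open Exp commutativeSemiring
  open RingProperties ring

  -- Induction on the degree. Dividing by the linear factor of the first root keeps all other roots,
  -- since a field has no zero divisors; in degree 0 the polynomial is the constant 1 and has no
  -- root.
  roots-complete : ∀ {d} (as : Vec Carrier d) (rs : Fin d → Carrier) →
    (∀ {i j} → rs i ≈ rs j → i ≡ j) → (∀ i → eval as (rs i) ≈ 0#) →
    ∀ {x} → eval as x ≈ 0# → ∃[ i ] x ≈ rs i
  roots-complete []          rs rs-injective rs-roots root = contradiction root 1≉0
  roots-complete as@(_ ∷ _) rs rs-injective rs-roots {x} root with x ≟ rs zero
  ... | yes x≈r = zero , x≈r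
  ... | no  x≉r =
    let (i , x≈rᵢ) = roots-complete (quotient as (rs zero)) (λ i → rs (suc i))
          (λ eq → suc-injective (rs-injective eq))
          (λ i → quotient-root (rs-roots (suc i)) (λ eq → contradiction (rs-injective eq) (λ ())))
          (quotient-root root x≉r)
    in suc i , x≈rᵢ
    where
    quotient-root : ∀ {y} → eval as y ≈ 0# → ¬ y ≈ rs zero → eval (quotient as (rs zero)) y ≈ 0#
    quotient-root {y} y-root y≉r = xy≈0⇒y≈0
      (λ y-r≈0 → y≉r (x∙y⁻¹≈ε⇒x≈y y (rs zero) y-r≈0))
      (trans (sym (+-identityˡ _)) (trans (+-congʳ (sym (rs-roots zero)))
        (trans (sym (eval-quotient as (rs zero) y)) y-root)))

  -- The fixed elements are roots of X^q - X, so q distinct ones exhaust them. This will identify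
  -- the image of K in F as the set of all fixed elements.
  fixed-complete : ∀ {q} → 1 ℕ.< q → (rs : Fin q → Carrier) →
    (∀ {i j} → rs i ≈ rs j → i ≡ j) → (∀ i → Fixed commutativeSemiring q (rs i)) →
    ∀ {x} → Fixed commutativeSemiring q x → ∃[ i ] x ≈ rs i
  fixed-complete {suc zero} (ℕ.s≤s ())
  fixed-complete {suc (suc d)} _ rs rs-injective rs-fixed x-fixed =
    roots-complete X^q-X rs rs-injective (λ i → fixed⇒root (rs-fixed i)) (fixed⇒root x-fixed)
    where
    -- The term X^q is implicit in the encoding; q ≥ 2 keeps it apart from the term - X.
    X^q-X = 0# ∷ - 1# ∷ replicate d 0#
    open import Relation.Binary.Reasoning.Setoid setoid
    fixed⇒root : ∀ {y} → Fixed commutativeSemiring (suc (suc d)) y → eval X^q-X y ≈ 0#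
    fixed⇒root {y} y^q≈y = begin
      0# + y * (- 1# + y * eval (replicate d 0#) y)  ≈⟨ +-identityˡ _ ⟩
      y * (- 1# + y * eval (replicate d 0#) y)       ≈⟨ *-congˡ (+-congˡ (*-congˡ (eval-replicate-0 d y))) ⟩
      y * (- 1# + y * y ^ d)                         ≈⟨ distribˡ y _ _ ⟩
      y * - 1# + y ^ suc (suc d)                     ≈⟨ +-cong (sym (-‿distribʳ-* y 1#)) y^q≈y ⟩
      - (y * 1#) + y                                 ≈⟨ +-congʳ (-‿cong (*-identityʳ y)) ⟩
      - y + y                                        ≈⟨ -‿inverseˡ y ⟩
      0#                                             ∎

-- Characteristic and homomorphisms of finite fields

module _ (F : HeytingField c ℓ ℓ#) (p k : ℕ) (card : HasCardinality (Field.setoid F) (p ℕ.^ k)) where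
  open FiniteField F card
  open Exp commutativeSemiring
  open SemiringMult semiring using (×1-homo-*; ×-homo-1) renaming (_×_ to _×′_)

  ×1-homo-^ : ∀ m j → (m ℕ.^ j) ×′ 1# ≈ (m ×′ 1#) ^ j
  ×1-homo-^ m zero    = ×-homo-1 1#
  ×1-homo-^ m (suc j) = trans (×1-homo-* m (m ℕ.^ j)) (*-congˡ (×1-homo-^ m j))

  -- The k-th power of `p ×′ 1#` is the cardinality times `1#`, hence zero, and a field has no
  -- nonzero nilpotent elements.
  characteristic : p ×′ 1# ≈ 0#
  characteristic = xᵏ≈0⇒x≈0 _ k (trans (sym (×1-homo-^ p k)) (N×x≈0 1#))

module FieldHomomorphism
  (K : HeytingField c ℓ ℓ#) {M : ℕ} (K-card : HasCardinality (Field.setoid K) M)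
  (F : HeytingField c′ ℓ′ ℓ#′) {N : ℕ} (F-card : HasCardinality (Field.setoid F) N)
  {ι : HeytingField.Carrier K → HeytingField.Carrier F}
  (ι-hom : RingMorphisms.IsRingHomomorphism (Field.rawRing K) (Field.rawRing F) ι)
  where
  private
    module K = FiniteField K K-card
    module F = FiniteField F F-card
    open Exp K.commutativeSemiring using () renaming (_^_ to _^ᴷ_)
    open Exp F.commutativeSemiring using () renaming (_^_ to _^ꟳ_)
  open RingMorphisms.IsRingHomomorphism ι-hom

  -- If x had an inverse, its image would be an inverse of `ι x`, which is zero.
  zero-reflecting : ∀ {x} → ι x F.≈ F.0# → x K.≈ K.0#
  zero-reflecting {x} ιx≈0 with x K.≟ K.0#
  ... | yes x≈0 = x≈0
  ... | no  x≉0 = let (y , xy≈1) = K.inverse x≉0 in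
    contradiction
      (F.trans (F.sym 1#-homo) (F.trans (F.sym (⟦⟧-cong xy≈1)) (F.trans (*-homo x y)
        (F.trans (F.*-congʳ ιx≈0) (F.zeroˡ (ι y))))))
      F.1≉0

  injective : ∀ {x y} → ι x F.≈ ι y → x K.≈ y
  injective {x} {y} ιx≈ιy = RingProperties.x∙y⁻¹≈ε⇒x≈y K.ring x y (zero-reflecting
    (F.trans (+-homo x (K.- y)) (F.trans (F.+-cong ιx≈ιy (-‿homo y)) (F.-‿inverseʳ (ι y)))))

  ^-homo : ∀ x k → ι (x ^ᴷ k) F.≈ ι x ^ꟳ k
  ^-homo x zero    = 1#-homo
  ^-homo x (suc k) = F.trans (*-homo x (x ^ᴷ k)) (F.*-congˡ (^-homo x k))

-- Eigenvectors of the semilinear map f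

module _ (F : HeytingField c ℓ ℓ#) {N : ℕ} (card : HasCardinality (Field.setoid F) N) where
  open FiniteField F card
  open RingMorphisms rawRing rawRing using (IsRingHomomorphism)

  module Semilinear
    {σ τ : Carrier → Carrier} (σ-hom : IsRingHomomorphism σ) (τ-hom : IsRingHomomorphism τ)
    (στ≈τσ : ∀ x → σ (τ x) ≈ τ (σ x)) (ττ≈id : ∀ x → τ (τ x) ≈ x)
    {α β : Carrier} (norms-differ : ¬ τ α * α ≈ τ β * β)
    {f : Carrier → Carrier} (f-def : ∀ x → f x ≈ α * σ x + β * σ (τ x))
    where
    private
      module σ = RingMorphisms.IsRingHomomorphism σ-hom
      module τ = RingMorphisms.IsRingHomomorphism τ-hom
      open FieldHomomorphism F card F card σ-hom using () renaming (zero-reflecting to σ-reflects-0)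
      open FieldHomomorphism F card F card τ-hom using () renaming (zero-reflecting to τ-reflects-0)
    open RingProperties ring
    open IntegerCoefficients commutativeRing using (solve; _:+_; _:*_; _:-_; :-_; _:=_)
    open import Relation.Binary.Reasoning.Setoid setoid

    -- Plays the role of membership in 𝔽_q: for σ = x^(q^s) and τ = x^(q^n) with s and n coprime,
    -- these elements form the image of K.
    Invariant : Carrier → Set _
    Invariant a = σ a ≈ a × τ a ≈ a

    -- Says that (x , f x) lies on the line spanned by (1 , m), so a point of slope m meets the
    -- graph of f in the eigenvectors for m.
    Eigen : Carrier → Carrier → Set _
    Eigen m x = f x ≈ m * x

    -- For x ≠ 0 this vanishes exactly when y / x is fixed by τ.
    Δ : Carrier → Carrier → Carrier
    Δ x y = x * τ y - y * τ x

    D : Carrier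
    D = τ α * α - τ β * β

    D≉0 : ¬ D ≈ 0#
    D≉0 D≈0 = norms-differ (x∙y⁻¹≈ε⇒x≈y _ _ D≈0)

    f-cong : ∀ {x y} → x ≈ y → f x ≈ f y
    f-cong {x} {y} x≈y = begin
      f x                        ≈⟨ f-def x ⟩
      α * σ x + β * σ (τ x)      ≈⟨ +-cong (*-congˡ (σ.⟦⟧-cong x≈y)) (*-congˡ (σ.⟦⟧-cong (τ.⟦⟧-cong x≈y))) ⟩
      α * σ y + β * σ (τ y)      ≈⟨ f-def y ⟨
      f y                        ∎

    f-+ : ∀ x y → f (x + y) ≈ f x + f y
    f-+ x y = begin
      f (x + y)                                          ≈⟨ f-def (x + y) ⟩
      α * σ (x + y) + β * σ (τ (x + y))
        ≈⟨ +-cong (*-congˡ (σ.+-homo x y)) (*-congˡ (trans (σ.⟦⟧-cong (τ.+-homo x y)) (σ.+-homo (τ x) (τ y)))) ⟩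
      α * (σ x + σ y) + β * (σ (τ x) + σ (τ y))
        ≈⟨ solve 6 (λ α β x y x′ y′ →
             α :* (x :+ y) :+ β :* (x′ :+ y′) := (α :* x :+ β :* x′) :+ (α :* y :+ β :* y′))
             refl α β (σ x) (σ y) (σ (τ x)) (σ (τ y)) ⟩
      (α * σ x + β * σ (τ x)) + (α * σ y + β * σ (τ y))  ≈⟨ +-cong (f-def x) (f-def y) ⟨
      f x + f y                                          ∎

    -- The two terms of f scale by σ a and σ (τ a), which agree for a fixed by τ.
    f-* : ∀ {a} → τ a ≈ a → ∀ x → f (a * x) ≈ σ a * f x
    f-* {a} τa≈a x = begin
      f (a * x)                                  ≈⟨ f-def (a * x) ⟩
      α * σ (a * x) + β * σ (τ (a * x))
        ≈⟨ +-cong (*-congˡ (σ.*-homo a x)) (*-congˡ (trans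
             (σ.⟦⟧-cong (trans (τ.*-homo a x) (*-congʳ τa≈a))) (σ.*-homo a (τ x)))) ⟩
      α * (σ a * σ x) + β * (σ a * σ (τ x))
        ≈⟨ solve 5 (λ α β a x x′ → α :* (a :* x) :+ β :* (a :* x′) := a :* (α :* x :+ β :* x′))
             refl α β (σ a) (σ x) (σ (τ x)) ⟩
      σ a * (α * σ x + β * σ (τ x))              ≈⟨ *-congˡ (f-def x) ⟨
      σ a * f x                                  ∎

    f-0 : f 0# ≈ 0#
    f-0 = x+x≈x⇒x≈0 (f 0#) (trans (sym (f-+ 0# 0#)) (f-cong (+-identityʳ 0#)))

    f-linear : ∀ {a b} → Invariant a → Invariant b → ∀ x y → f (a * x + b * y) ≈ a * f x + b * f y
    f-linear (σa≈a , τa≈a) (σb≈b , τb≈b) x y = trans (f-+ _ _)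
      (+-cong (trans (f-* τa≈a x) (*-congʳ σa≈a)) (trans (f-* τb≈b y) (*-congʳ σb≈b)))

    Eigen-scale : ∀ {m x a} → Invariant a → Eigen m x → Eigen m (a * x)
    Eigen-scale {m} {x} {a} (σa≈a , τa≈a) eigen = begin
      f (a * x)     ≈⟨ f-* τa≈a x ⟩
      σ a * f x     ≈⟨ *-cong σa≈a eigen ⟩
      a * (m * x)   ≈⟨ solve 3 (λ a m x → a :* (m :* x) := m :* (a :* x)) refl a m x ⟩
      m * (a * x)   ∎

    Eigen-+ : ∀ {m x y} → Eigen m x → Eigen m y → Eigen m (x + y)
    Eigen-+ {m} {x} {y} x-eigen y-eigen =
      trans (f-+ x y) (trans (+-cong x-eigen y-eigen) (sym (distribˡ m x y)))

    -- As an involution commuting with σ, τ interchanges σ x and σ (τ x). Applied to the eigenvector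
    -- equation it therefore gives a second equation in the same two unknowns.
    τ-Eigen : ∀ {m x} → Eigen m x → τ β * σ x + τ α * σ (τ x) ≈ τ m * τ x
    τ-Eigen {m} {x} eigen = begin
      τ β * σ x + τ α * σ (τ x)               ≈⟨ +-comm _ _ ⟩
      τ α * σ (τ x) + τ β * σ x
        ≈⟨ +-cong (*-congˡ (στ≈τσ x)) (*-congˡ (trans (sym (σ.⟦⟧-cong (ττ≈id x))) (στ≈τσ (τ x)))) ⟩
      τ α * τ (σ x) + τ β * τ (σ (τ x))       ≈⟨ +-cong (τ.*-homo α (σ x)) (τ.*-homo β (σ (τ x))) ⟨
      τ (α * σ x) + τ (β * σ (τ x))           ≈⟨ τ.+-homo _ _ ⟨
      τ (α * σ x + β * σ (τ x))               ≈⟨ τ.⟦⟧-cong (trans (sym (f-def x)) eigen) ⟩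
      τ (m * x)                               ≈⟨ τ.*-homo m x ⟩
      τ m * τ x                               ∎

    -- With X = (x , τ x), an eigenvector satisfies B (σ X) = diag (m , τ m) X for
    -- the matrix B = (α , β ; τ β , τ α) of determinant D; Δ x y = det (X , Y).
    σ-Δ : ∀ {m x y} → Eigen m x → Eigen m y → D * σ (Δ x y) ≈ m * τ m * Δ x y
    σ-Δ {m} {x} {y} x-eigen y-eigen = begin
      D * σ (Δ x y)                                      ≈⟨ *-congˡ (trans (σ.+-homo _ _) (+-cong
                                                              (σ.*-homo x (τ y))
                                                              (trans (σ.-‿homo _) (-‿cong (σ.*-homo y (τ x)))))) ⟩
      D * (σ x * σ (τ y) - σ y * σ (τ x))                ≈⟨ determinant-multiplicative commutativeRing
                                                              α β (τ β) (τ α) (σ x) (σ (τ x)) (σ y) (σ (τ y)) ⟨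
      (α * σ x + β * σ (τ x)) * (τ β * σ y + τ α * σ (τ y)) -
      (α * σ y + β * σ (τ y)) * (τ β * σ x + τ α * σ (τ x))
        ≈⟨ +-cong (*-cong (row x-eigen) (τ-Eigen y-eigen)) (-‿cong (*-cong (row y-eigen) (τ-Eigen x-eigen))) ⟩
      (m * x) * (τ m * τ y) - (m * y) * (τ m * τ x)
        ≈⟨ solve 6 (λ m m′ x x′ y y′ →
             (m :* x) :* (m′ :* y′) :- (m :* y) :* (m′ :* x′) := m :* m′ :* (x :* y′ :- y :* x′))
             refl m (τ m) x (τ x) y (τ y) ⟩
      m * τ m * Δ x y                                    ∎
      where
      row : ∀ {z} → Eigen m z → α * σ z + β * σ (τ z) ≈ m * z
      row {z} eigen = trans (sym (f-def z)) eigen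

    -- Applying τ swaps the entries of (x , τ x) and of (y , τ y), that is, two rows of the
    -- determinant.
    τ-Δ : ∀ x y → τ (Δ x y) ≈ - Δ x y
    τ-Δ x y = begin
      τ (Δ x y)                        ≈⟨ trans (τ.+-homo _ _) (+-cong (τ.*-homo x (τ y))
                                            (trans (τ.-‿homo _) (-‿cong (τ.*-homo y (τ x))))) ⟩
      τ x * τ (τ y) - τ y * τ (τ x)    ≈⟨ +-cong (*-congˡ (ττ≈id y)) (-‿cong (*-congˡ (ττ≈id x))) ⟩
      τ x * y - τ y * x                ≈⟨ solve 4 (λ x y x′ y′ → x′ :* y :- y′ :* x := :- (x :* y′ :- y :* x′))
                                            refl x y (τ x) (τ y) ⟩
      - Δ x y                          ∎

    -- By `σ-Δ` and `τ-Δ`, σ multiplies every value of Δ on eigenvectors for m by the same factor m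
    -- τ(m) / D, and τ multiplies it by -1; these factors cancel in the quotient a.
    ratio-invariant : ∀ {m x y z w a} → Eigen m x → Eigen m y → Eigen m z → Eigen m w →
                      ¬ Δ x y ≈ 0# → Δ z w ≈ a * Δ x y → Invariant a
    ratio-invariant {m} {x} {y} {z} {w} {a} x-eigen y-eigen z-eigen w-eigen Δ≉0 Δzw≈aΔxy =
      *-cancelʳ (*-nonzero D≉0 (λ σΔ≈0 → Δ≉0 (σ-reflects-0 σΔ≈0))) (begin
        σ a * (D * σ (Δ x y))        ≈⟨ x∙yz≈y∙xz (σ a) D _ ⟩
        D * (σ a * σ (Δ x y))        ≈⟨ *-congˡ (trans (σ.⟦⟧-cong Δzw≈aΔxy) (σ.*-homo a (Δ x y))) ⟨
        D * σ (Δ z w)                ≈⟨ σ-Δ z-eigen w-eigen ⟩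
        m * τ m * Δ z w              ≈⟨ *-congˡ Δzw≈aΔxy ⟩
        m * τ m * (a * Δ x y)        ≈⟨ x∙yz≈y∙xz (m * τ m) a _ ⟩
        a * (m * τ m * Δ x y)        ≈⟨ *-congˡ (σ-Δ x-eigen y-eigen) ⟨
        a * (D * σ (Δ x y))          ∎) ,
      *-cancelʳ (λ τΔ≈0 → Δ≉0 (τ-reflects-0 τΔ≈0)) (begin
        τ a * τ (Δ x y)              ≈⟨ trans (τ.⟦⟧-cong Δzw≈aΔxy) (τ.*-homo a (Δ x y)) ⟨
        τ (Δ z w)                    ≈⟨ τ-Δ z w ⟩
        - Δ z w                      ≈⟨ -‿cong Δzw≈aΔxy ⟩
        - (a * Δ x y)                ≈⟨ -‿distribʳ-* a (Δ x y) ⟩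
        a * - Δ x y                  ≈⟨ *-congˡ (τ-Δ x y) ⟨
        a * τ (Δ x y)                ∎)
      where
      x∙yz≈y∙xz : ∀ x y z → x * (y * z) ≈ y * (x * z)
      x∙yz≈y∙xz = solve 3 (λ x y z → x :* (y :* z) := y :* (x :* z)) refl

    -- For m = 0 the linear system for σ x and σ (τ x) is homogeneous; eliminating σ (τ x) leaves D
    -- σ(x) = 0. Thus f has trivial kernel.
    Eigen-0 : ∀ {x} → Eigen 0# x → x ≈ 0#
    Eigen-0 {x} eigen = σ-reflects-0 (xy≈0⇒y≈0 D≉0 (begin
      D * σ x
        ≈⟨ solve 6 (λ α β α′ β′ x x′ →
             (α′ :* α :- β′ :* β) :* x := α′ :* (α :* x :+ β :* x′) :- β :* (β′ :* x :+ α′ :* x′))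
             refl α β (τ α) (τ β) (σ x) (σ (τ x)) ⟩
      τ α * (α * σ x + β * σ (τ x)) - β * (τ β * σ x + τ α * σ (τ x))
        ≈⟨ +-cong (*-congˡ (trans (sym (f-def x)) (trans eigen (zeroˡ x))))
                  (-‿cong (*-congˡ (trans (τ-Eigen eigen) (trans (*-congʳ τ.0#-homo) (zeroˡ (τ x)))))) ⟩
      τ α * 0# - β * 0#  ≈⟨ +-cong (zeroʳ (τ α)) (trans (-‿cong (zeroʳ β)) -0#≈0#) ⟩
      0# + 0#            ≈⟨ +-identityʳ 0# ⟩
      0#                 ∎))

    -- The relation and its image under τ form a homogeneous system for a and b with determinant Δ x
    -- y.
    independent : ∀ {x y a b} → ¬ Δ x y ≈ 0# → Invariant a → Invariant b →
                  a * x + b * y ≈ 0# → a ≈ 0# × b ≈ 0#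
    independent {x} {y} {a} {b} Δ≉0 (_ , τa≈a) (_ , τb≈b) ax+by≈0 =
      annihilates (begin
        Δ x y * a
          ≈⟨ solve 6 (λ a b x y x′ y′ → (x :* y′ :- y :* x′) :* a :=
               y′ :* (a :* x :+ b :* y) :- y :* (a :* x′ :+ b :* y′)) refl a b x y (τ x) (τ y) ⟩
        τ y * (a * x + b * y) - y * (a * τ x + b * τ y)  ≈⟨ both-vanish (τ y) y ⟩
        0#                                               ∎) ,
      annihilates (begin
        Δ x y * b
          ≈⟨ solve 6 (λ a b x y x′ y′ → (x :* y′ :- y :* x′) :* b :=
               (:- x′) :* (a :* x :+ b :* y) :- (:- x) :* (a :* x′ :+ b :* y′)) refl a b x y (τ x) (τ y) ⟩
        - τ x * (a * x + b * y) - - x * (a * τ x + b * τ y)  ≈⟨ both-vanish (- τ x) (- x) ⟩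
        0#                                                   ∎)
      where
      annihilates : ∀ {c} → Δ x y * c ≈ 0# → c ≈ 0#
      annihilates = xy≈0⇒y≈0 Δ≉0
      aτx+bτy≈0 : a * τ x + b * τ y ≈ 0#
      aτx+bτy≈0 = begin
        a * τ x + b * τ y          ≈⟨ +-cong (*-congʳ τa≈a) (*-congʳ τb≈b) ⟨
        τ a * τ x + τ b * τ y      ≈⟨ +-cong (τ.*-homo a x) (τ.*-homo b y) ⟨
        τ (a * x) + τ (b * y)      ≈⟨ τ.+-homo _ _ ⟨
        τ (a * x + b * y)          ≈⟨ τ.⟦⟧-cong ax+by≈0 ⟩
        τ 0#                       ≈⟨ τ.0#-homo ⟩
        0#                         ∎
      both-vanish : ∀ u v → u * (a * x + b * y) - v * (a * τ x + b * τ y) ≈ 0#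
      both-vanish u v = begin
        u * (a * x + b * y) - v * (a * τ x + b * τ y)
          ≈⟨ +-cong (*-congˡ ax+by≈0) (-‿cong (*-congˡ aτx+bτy≈0)) ⟩
        u * 0# - v * 0#    ≈⟨ +-cong (zeroʳ u) (trans (-‿cong (zeroʳ v)) -0#≈0#) ⟩
        0# + 0#            ≈⟨ +-identityʳ 0# ⟩
        0#                 ∎

    -- Cramer's rule gives the coefficients Δ z y / Δ x y and Δ x z / Δ x y, which are quotients as
    -- in `ratio-invariant`.
    span₂ : ∀ {m x y z} → Eigen m x → Eigen m y → Eigen m z → ¬ Δ x y ≈ 0# →
            ∃[ a ] ∃[ b ] Invariant a × Invariant b × z ≈ a * x + b * y
    span₂ {m} {x} {y} {z} x-eigen y-eigen z-eigen Δ≉0 =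
      let (a , Δzy≈aΔxy) = divide Δ≉0 (Δ z y)
          (b , Δxz≈bΔxy) = divide Δ≉0 (Δ x z)
      in a , b
       , ratio-invariant x-eigen y-eigen z-eigen y-eigen Δ≉0 Δzy≈aΔxy
       , ratio-invariant x-eigen y-eigen x-eigen z-eigen Δ≉0 Δxz≈bΔxy
       , *-cancelʳ Δ≉0 (begin
           z * Δ x y                          ≈⟨ cramer commutativeRing x y z (τ x) (τ y) (τ z) ⟩
           Δ z y * x + Δ x z * y              ≈⟨ +-cong (*-congʳ Δzy≈aΔxy) (*-congʳ Δxz≈bΔxy) ⟩
           a * Δ x y * x + b * Δ x y * y
             ≈⟨ solve 5 (λ a b x y d → a :* d :* x :+ b :* d :* y := (a :* x :+ b :* y) :* d)
                  refl a b x y (Δ x y) ⟩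
           (a * x + b * y) * Δ x y            ∎)

    -- The quotient a = z / x is fixed by τ because Δ x z vanishes. Hence f (a x) = σ(a) f(x), while
    -- z being an eigenvector gives f (a x) = a f(x); cancelling f(x), nonzero by `Eigen-0`, shows
    -- that σ fixes a.
    span₁ : ∀ {m x z} → ¬ x ≈ 0# → Eigen m x → Eigen m z → Δ x z ≈ 0# →
            ∃[ a ] Invariant a × z ≈ a * x
    span₁ {m} {x} {z} x≉0 x-eigen z-eigen Δ≈0 =
      let (a , z≈ax) = divide x≉0 z in a , (σ-invariant z≈ax , τ-invariant z≈ax) , z≈ax
      where
      τx≉0 : ¬ τ x ≈ 0#
      τx≉0 τx≈0 = x≉0 (τ-reflects-0 τx≈0)
      fx≉0 : ¬ f x ≈ 0#
      fx≉0 fx≈0 = x≉0 (Eigen-0 (trans fx≈0 (sym (zeroˡ x))))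
      τ-invariant : ∀ {a} → z ≈ a * x → τ a ≈ a
      τ-invariant {a} z≈ax = *-cancelʳ (*-nonzero x≉0 τx≉0) (begin
        τ a * (x * τ x)     ≈⟨ solve 3 (λ a x x′ → a :* (x :* x′) := x :* (a :* x′)) refl (τ a) x (τ x) ⟩
        x * (τ a * τ x)     ≈⟨ *-congˡ (trans (τ.⟦⟧-cong z≈ax) (τ.*-homo a x)) ⟨
        x * τ z             ≈⟨ x∙y⁻¹≈ε⇒x≈y _ _ Δ≈0 ⟩
        z * τ x             ≈⟨ *-congʳ z≈ax ⟩
        a * x * τ x         ≈⟨ *-assoc a x (τ x) ⟩
        a * (x * τ x)       ∎)
      σ-invariant : ∀ {a} → z ≈ a * x → σ a ≈ a
      σ-invariant {a} z≈ax = *-cancelʳ fx≉0 (begin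
        σ a * f x      ≈⟨ f-* (τ-invariant z≈ax) x ⟨
        f (a * x)      ≈⟨ f-cong z≈ax ⟨
        f z            ≈⟨ z-eigen ⟩
        m * z          ≈⟨ *-congˡ z≈ax ⟩
        m * (a * x)    ≈⟨ solve 3 (λ a m x → m :* (a :* x) := a :* (m :* x)) refl a m x ⟩
        a * (m * x)    ≈⟨ *-congˡ x-eigen ⟨
        a * f x        ∎)

-- Weights of the points of the linear set

prime-power>1 : ∀ {q} → IsPrimePower q → 1 ℕ.< q
prime-power>1 (p , e , p-prime , 1≤e , ≡.refl) = ℕ.<-≤-trans
  (ℕ.nonTrivial⇒n>1 p {{prime⇒nonTrivial p-prime}})
  (≡.subst (ℕ._≤ p ℕ.^ e) (ℕ.*-identityʳ p) (ℕ.^-monoʳ-≤ p {{prime⇒nonZero p-prime}} 1≤e))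

open import Data.Nat.Base using (_≤_; _*_; _^_)

module Weights
  (q n s : ℕ) (q-prime-power : IsPrimePower q) (gcd≡1 : gcd s n ≡ 1)
  (K : HeytingField c ℓ ℓ#) (K-card : HasCardinality (Field.setoid K) q)
  (F : HeytingField c′ ℓ′ ℓ#′) (F-card : HasCardinality (Field.setoid F) (q ^ (2 * n)))
  (ι : HeytingField.Carrier K → HeytingField.Carrier F)
  (ι-hom : RingMorphisms.IsRingHomomorphism (Field.rawRing K) (Field.rawRing F) ι)
  (α β : HeytingField.Carrier F)
  (norms-differ : ¬ (HeytingField._≈_ F (norm F q n α) (norm F q n β)))
  where

  private
    module K = FiniteField K K-card
  open FiniteField F F-card renaming (_*_ to infixl 7 _·_)
  open Exp commutativeSemiring using (^-congˡ; ^-homo-*; ^-assocʳ) renaming (_^_ to infixr 8 _^ꟳ_)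
  open RingMorphisms rawRing rawRing using (IsRingHomomorphism)
  open import Relation.Binary.Reasoning.Setoid setoid
  private module ι = RingMorphisms.IsRingHomomorphism ι-hom
  open Extension K F ι-hom

  φ : ℕ → Carrier → Carrier
  φ k x = x ^ꟳ (q ^ k)

  -- With q = p^e the field F has p^(2ne) elements, hence characteristic p, and `φ k` is an iterate
  -- of the additive map x^p.
  φ-homomorphism : ∀ k → IsRingHomomorphism (φ k)
  φ-homomorphism k =
    let (p , e , p-prime , _ , q≡p^e) = q-prime-power
        card = ≡.subst (HasCardinality (Field.setoid F))
          (≡.trans (≡.cong (_^ (2 * n)) q≡p^e) (ℕ.^-*-assoc p e (2 * n))) F-card
        p-additive = freshman's-dream commutativeSemiring p-prime (characteristic F p (e * (2 * n)) card)
    in additive⇒homomorphism commutativeRing (q ^ k)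
      (≡.subst (λ r → Additive commutativeSemiring (r ^ k)) (≡.sym q≡p^e)
        (additive-^ commutativeSemiring (additive-^ commutativeSemiring p-additive e) k))

  φ-+ : ∀ j k x → φ j (φ k x) ≈ φ (k ℕ.+ j) x
  φ-+ j k x = trans (^-assocʳ x (q ^ k) (q ^ j))
    (reflexive (≡.cong (x ^ꟳ_) (≡.sym (ℕ.^-distribˡ-+-* q k j))))

  φ-comm : ∀ j k x → φ j (φ k x) ≈ φ k (φ j x)
  φ-comm j k x = trans (φ-+ j k x)
    (trans (reflexive (≡.cong (λ i → φ i x) (ℕ.+-comm k j))) (sym (φ-+ k j x)))

  φ-involutive : ∀ x → φ n (φ n x) ≈ x
  φ-involutive x = trans (φ-+ n n x)
    -- The exponent 2 * n unfolds to n + (n + 0), and x^(q^(2n)) = x because F has q^(2n) elements.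
    (trans (reflexive (≡.cong (λ i → φ (n ℕ.+ i) x) (≡.sym (ℕ.+-identityʳ n)))) (x^N≈x x))

  norm≈ : ∀ x → norm F q n x ≈ φ n x · x
  norm≈ x = trans (^-homo-* x (q ^ n) 1) (*-congˡ (*-identityʳ x))

  f : Carrier → Carrier
  f = binomial F q n s α β

  f-def : ∀ x → f x ≈ α · φ s x + β · φ s (φ n x)
  f-def x = +-congˡ (*-congˡ (sym (trans (φ-+ s n x)
    (reflexive (≡.cong (λ i → φ i x) (ℕ.+-comm n s))))))

  powers-differ : ¬ φ n α · α ≈ φ n β · β
  powers-differ eq = norms-differ (trans (norm≈ α) (trans eq (sym (norm≈ β))))

  open Semilinear F F-card (φ-homomorphism s) (φ-homomorphism n) (φ-comm s n) φ-involutive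
    powers-differ f-def

  ι-fixed : ∀ k → Fixed commutativeSemiring q (ι k)
  ι-fixed k = trans (sym (^-homo k q)) (ι.⟦⟧-cong (K.x^N≈x k))
    where open FieldHomomorphism K K-card F F-card ι-hom using (^-homo)

  ι-invariant : ∀ k → Invariant (ι k)
  ι-invariant k = fixed s , fixed n
    where
    fixed : ∀ j → φ j (ι k) ≈ ι k
    fixed j = ≡.subst (λ i → φ i (ι k) ≈ ι k) (ℕ.*-identityʳ j)
      (fixed-^ commutativeSemiring q 1
        (≡.subst (λ r → ι k ^ꟳ r ≈ ι k) (≡.sym (ℕ.*-identityʳ q)) (ι-fixed k)) j)

  -- Coprimality of s and n makes x fixed by the q-th power, and the q elements of the image of K
  -- are already all such elements.
  invariant⇒ι : ∀ {x} → Invariant x → ∃[ k ] x ≈ ι k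
  invariant⇒ι (s-fixed , n-fixed) =
    let (i , x≈ιi) = fixed-complete F F-card (prime-power>1 q-prime-power)
          (λ i → ι (Inverse.from K-card i))
          (λ {i} {j} eq → ≡.trans (≡.sym (Inverse.strictlyInverseˡ K-card i))
            (≡.trans (Inverse.to-cong K-card (injective eq)) (Inverse.strictlyInverseˡ K-card j)))
          (λ i → ι-fixed (Inverse.from K-card i))
          (fixed-coprime commutativeSemiring q s n gcd≡1 s-fixed n-fixed)
    in Inverse.from K-card i , x≈ιi
    where open FieldHomomorphism K K-card F F-card ι-hom using (injective)

  module _ {P : Pred (Carrier × Carrier) _} (P∈L : P ∈ LinearSet (Graph f)) where
    private
      u = proj₁ P∈L
      u∈U = proj₁ (proj₂ P∈L)
      u≉0 = proj₁ (proj₂ (proj₂ P∈L))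
      P≐⟨u⟩ = proj₂ (proj₂ (proj₂ P∈L))
      x = proj₁ u∈U
      u≈ = proj₂ u∈U

    x≉0 : ¬ x ≈ 0#
    x≉0 x≈0 = u≉0 (trans (proj₁ u≈) x≈0 , trans (proj₂ u≈) (trans (f-cong x≈0) f-0))

    private
      -- The slope f(x) / x of the point P, which is spanned by (x , f x).
      m = proj₁ (divide x≉0 (f x))

    x-eigen : Eigen m x
    x-eigen = proj₂ (divide x≉0 (f x))

    OnGraph : Carrier × Carrier → Carrier → Set _
    OnGraph (w₁ , w₂) y = w₁ ≈ y × w₂ ≈ f y

    -- Every multiple of u = (x , m x) has second coordinate m times its first.
    to-eigen : ∀ {w} → w ∈ P ∩ Graph f → ∃[ y ] OnGraph w y × Eigen m y
    to-eigen (w∈P , y , w₁≈y , w₂≈fy) =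
      let (t , w₁≈tu₁ , w₂≈tu₂) = proj₁ P≐⟨u⟩ w∈P
      in y , (w₁≈y , w₂≈fy) , (begin
        f y             ≈⟨ w₂≈fy ⟨
        _               ≈⟨ w₂≈tu₂ ⟩
        t · proj₂ u     ≈⟨ *-congˡ (trans (proj₂ u≈) x-eigen) ⟩
        t · (m · x)     ≈⟨ *-assoc t m x ⟨
        t · m · x       ≈⟨ *-congʳ (*-comm t m) ⟩
        m · t · x       ≈⟨ *-assoc m t x ⟩
        m · (t · x)     ≈⟨ *-congˡ (*-congˡ (proj₁ u≈)) ⟨
        m · (t · proj₁ u)  ≈⟨ *-congˡ w₁≈tu₁ ⟨
        m · _           ≈⟨ *-congˡ w₁≈y ⟩
        m · y           ∎)

    -- The vector is the multiple of u by t = y / x.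
    from-eigen : ∀ {w y} → OnGraph w y → Eigen m y → w ∈ P ∩ Graph f
    from-eigen {w} {y} (w₁≈y , w₂≈fy) y-eigen =
      let (t , y≈tx) = divide x≉0 y
      in proj₂ P≐⟨u⟩ (t ,
           trans w₁≈y (trans y≈tx (*-congˡ (sym (proj₁ u≈)))) ,
           (begin
             proj₂ w         ≈⟨ w₂≈fy ⟩
             f y             ≈⟨ y-eigen ⟩
             m · y           ≈⟨ *-congˡ y≈tx ⟩
             m · (t · x)     ≈⟨ *-assoc m t x ⟨
             m · t · x       ≈⟨ *-congʳ (*-comm m t) ⟩
             t · m · x       ≈⟨ *-assoc t m x ⟩
             t · (m · x)     ≈⟨ *-congˡ (trans (proj₂ u≈) x-eigen) ⟨
             t · proj₂ u     ∎)) ,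
         y , w₁≈y , w₂≈fy

    open FieldHomomorphism K K-card F F-card ι-hom using (zero-reflecting)

    -- By `span₁` the single vector (x , f x) is a basis of the intersection over K.
    weight≡1 : (∀ {y} → Eigen m y → Δ x y ≈ 0#) → HasWeight (Graph f) P 1
    weight≡1 Δ≈0 = v , independent₁ , ⊆-span , span-⊆
      where
      v : Vector (Carrier × Carrier) 1
      v _ = x , f x
      independent₁ : LinearlyIndependent F×F-over-K v
      independent₁ r (rx+0≈0 , _) zero = zero-reflecting
        (xy≈0⇒y≈0 x≉0 (trans (*-comm x _) (trans (sym (+-identityʳ _)) rx+0≈0)))
      ⊆-span : P ∩ Graph f ⊆ Span F×F-over-K v
      ⊆-span w∈ =
        let (z , (w₁≈z , w₂≈fz) , z-eigen) = to-eigen w∈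
            (a , a-inv , z≈ax) = span₁ x≉0 x-eigen z-eigen (Δ≈0 z-eigen)
            (k , a≈ιk) = invariant⇒ι a-inv
            z≈ιkx = trans z≈ax (*-congʳ a≈ιk)
            (s-fixed , n-fixed) = ι-invariant k
        in (λ _ → k) ,
           trans w₁≈z (trans z≈ιkx (sym (+-identityʳ _))) ,
           trans w₂≈fz (trans (f-cong z≈ιkx) (trans (f-* n-fixed x)
             (trans (*-congʳ s-fixed) (sym (+-identityʳ _)))))
      span-⊆ : Span F×F-over-K v ⊆ P ∩ Graph f
      span-⊆ (r , w₁≈ , w₂≈) =
        let (s-fixed , n-fixed) = ι-invariant (r zero)
        in from-eigen
          (trans w₁≈ (+-identityʳ _) ,
           trans w₂≈ (trans (+-identityʳ _) (trans (*-congʳ (sym s-fixed)) (sym (f-* n-fixed x)))))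
          (Eigen-scale (ι-invariant (r zero)) x-eigen)

    -- The vectors (x , f x) and (y , f y) form a basis over K: `independent` gives their
    -- independence, and `span₂` expresses every further eigenvector by x and y.
    weight≡2 : ∀ {y} → Eigen m y → ¬ Δ x y ≈ 0# → HasWeight (Graph f) P 2
    weight≡2 {y} y-eigen Δ≉0 = v , independent₂ , ⊆-span , span-⊆
      where
      v : Vector (Carrier × Carrier) 2
      v = (x , f x) Vector.∷ (y , f y) Vector.∷ Vector.[]
      drop-0 : ∀ {s t} → s + (t + 0#) ≈ s + t
      drop-0 = +-congˡ (+-identityʳ _)
      independent₂ : LinearlyIndependent F×F-over-K v
      independent₂ r (rx+sy≈0 , _) =
        let (a≈0 , b≈0) = independent Δ≉0 (ι-invariant (r zero)) (ι-invariant (r (suc zero)))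
              (trans (sym drop-0) rx+sy≈0)
        in λ { zero → zero-reflecting a≈0 ; (suc zero) → zero-reflecting b≈0 }
      ⊆-span : P ∩ Graph f ⊆ Span F×F-over-K v
      ⊆-span w∈ =
        let (z , (w₁≈z , w₂≈fz) , z-eigen) = to-eigen w∈
            (a , b , a-inv , b-inv , z≈ax+by) = span₂ x-eigen y-eigen z-eigen Δ≉0
            (k , a≈ιk) = invariant⇒ι a-inv
            (l , b≈ιl) = invariant⇒ι b-inv
            z≈ιkx+ιly = trans z≈ax+by (+-cong (*-congʳ a≈ιk) (*-congʳ b≈ιl))
        in k Vector.∷ l Vector.∷ Vector.[] ,
           trans w₁≈z (trans z≈ιkx+ιly (sym drop-0)) ,
           trans w₂≈fz (trans (f-cong z≈ιkx+ιly)
             (trans (f-linear (ι-invariant k) (ι-invariant l) x y) (sym drop-0)))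
      span-⊆ : Span F×F-over-K v ⊆ P ∩ Graph f
      span-⊆ (r , w₁≈ , w₂≈) = from-eigen
        (trans w₁≈ drop-0 ,
         trans w₂≈ (trans drop-0
           (sym (f-linear (ι-invariant (r zero)) (ι-invariant (r (suc zero))) x y))))
        (Eigen-+ (Eigen-scale (ι-invariant (r zero)) x-eigen)
                 (Eigen-scale (ι-invariant (r (suc zero))) y-eigen))

    SecondEigenvector : Carrier → Set _
    SecondEigenvector y = Eigen m y × ¬ Δ x y ≈ 0#

    secondEigenvector-resp : ∀ {y z} → y ≈ z → SecondEigenvector y → SecondEigenvector z
    secondEigenvector-resp {y} {z} y≈z (y-eigen , Δxy≉0) =
      trans (f-cong (sym y≈z)) (trans y-eigen (*-congˡ y≈z)) ,
      (λ Δxz≈0 → Δxy≉0 (trans (+-cong (*-congˡ (^-congˡ (q ^ n) y≈z)) (-‿cong (*-congʳ y≈z))) Δxz≈0))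

    secondEigenvector? : Dec (∃[ y ] SecondEigenvector y)
    secondEigenvector? = ∃? secondEigenvector-resp (λ y → (f y ≟ m · y) ×-dec ¬? (Δ x y ≟ 0#))

    weight≤2 : ∃[ w ] (HasWeight (Graph f) P w × w ≤ 2)
    weight≤2 = from-dec secondEigenvector?
      where
      from-dec : Dec (∃[ y ] SecondEigenvector y) → ∃[ w ] (HasWeight (Graph f) P w × w ≤ 2)
      from-dec (yes (y , y-eigen , Δ≉0)) = 2 , weight≡2 y-eigen Δ≉0 , ℕ.≤-refl
      from-dec (no ∄) = 1 , weight≡1 (λ {y} y-eigen →
        -- A failed search only refutes Δ x y ≠ 0; decidable equality turns this into Δ x y = 0.
        decidable-stable (Δ x y ≟ 0#) (λ Δ≉0 → ∄ (y , y-eigen , Δ≉0))) , ℕ.n≤1+n 1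

proposition4p1 :
    ∀ {c ℓ ℓ# c′ ℓ′ ℓ#′} (q n s : ℕ) →
    IsPrimePower q → 2 ≤ n → 1 ≤ s → s ≤ 2 * n ∸ 1 → gcd s n ≡ 1 →
    (K : HeytingField c ℓ ℓ#) → HasCardinality (Field.setoid K) q →
    (F : HeytingField c′ ℓ′ ℓ#′) → HasCardinality (Field.setoid F) (q ^ (2 * n)) →
    (ι : HeytingField.Carrier K → HeytingField.Carrier F) →
    (ι-hom : RingMorphisms.IsRingHomomorphism (Field.rawRing K) (Field.rawRing F) ι) →
    (α β : HeytingField.Carrier F) →
    ¬ (HeytingField._≈_ F (norm F q n α) (norm F q n β)) →
    let open Extension K F ι-hom
        Uf = Graph (binomial F q n s α β)
    in ∀ P → P ∈ LinearSet Uf → ∃[ w ] (HasWeight Uf P w × w ≤ 2)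
proposition4p1 q n s q-prime-power _ _ _ gcd≡1 K K-card F F-card ι ι-hom α β norms-differ P P∈L =
  Weights.weight≤2 q n s q-prime-power gcd≡1 K K-card F F-card ι ι-hom α β norms-differ P∈L
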